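{- Let $\nu=\nu_1\nu_2\cdots\nu_{k-1}$ be a word of distinct integers in $[k]$, let $r$ be the unique element of $[k]\setminus\{\nu_1,\ldots,\nu_{k-1}\}$, and let $i\in[k-1]$. If $r>\nu_i$ or $\nu_i\notin\mathrm{Lmax}(\nu)$, then $$(\nu;\,r\to\nu_i)\ \sim\ (\nu^{(i,r)};\,r\to\nu_i)\ \sim\ (\nu_1\cdots\nu_{i-1}\,r\,\nu_i\,\nu_{i+1}\cdots\nu_{k-1};\,r\to\nu_i),$$ where $\nu^{(i,r)}=\nu_1\cdots\nu_{i-1}\,r\,\nu_{i+1}\cdots\nu_{k-1}$ is the word obtained from $\nu$ by replacing the entry $\nu_i$ with $r$.
   Context: $[n]=\{1,\dots,n\}$, and $\mathcal{S}_n$ is the set of permutations $\pi=\pi_1\pi_2\cdots\pi_n$ of $[n]$ in one-line notation. For a word $w$ of distinct integers, $w_i$ is a left-to-right maximum if $w_i>w_j$ for all $j<i$; $\mathrm{Lmax}(w)$ is the set of all left-to-right maxima of $w$. The permutation $\hat\pi$: for $\pi\in\mathcal{S}_n$, $\hat\pi\in\mathcal{S}_n$ is the permutation whose cycle form is obtained from the word $\pi_1\cdots\pi_n$ by inserting a left parenthesis before each left-to-right maximum and a right parenthesis immediately before the next left-to-right maximum, or at the end of the word. A cycle $(c_1,c_2,\dots,c_s)$ means $c_1\mapsto c_2\mapsto\cdots\mapsto c_s\mapsto c_1$. Example: if $\pi=2537164$ then $\hat\pi=(2)(53)(7164)$. Arrow patterns: an arrow pattern of size $k$ is a pair $(\nu;H)$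 where $\nu=\nu_1\cdots\nu_m$ is a word of distinct positive integers, $H$ is a collection of arrows $b_i\to c_i$, and the set of all integers appearing in $\nu$ or $H$ is $[k]$. A permutation $\pi\in\mathcal{S}_n$ contains $(\nu;H)$ if there are a set $X=\{x_1<x_2<\cdots<x_k\}\subseteq[n]$ and indices $t_1<\cdots<t_m$ such that $\pi_{t_1}\pi_{t_2}\cdots\pi_{t_m}=x_{\nu_1}x_{\nu_2}\cdots x_{\nu_m}$ and $\hat\pi(x_{b_i})=x_{c_i}$ for every arrow $b_i\to c_i$ in $H$. Otherwise $\pi$ avoids $(\nu;H)$. $\mathcal{S}_n(\nu;H)$ is the set of permutations in $\mathcal{S}_n$ avoiding $(\nu;H)$. Two arrow patterns $\alpha,\beta$ are arrow-Wilf-equivalent, written $\alpha\sim\beta$, if $|\mathcal{S}_n(\alpha)|=|\mathcal{S}_n(\beta)|$ for all $n\ge 1$. -}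

module Defs where

open import Data.Fin using (Fin; zero; suc; _<_; inject₁)
open import Data.Fin.Properties using (_≟_; _<?_; any?; injective⇒≤)
open import Data.List using (List; []; _∷_; length; filter; foldr; cartesianProductWith; allFin)
open import Data.List.Relation.Unary.All using (All; all?)
open import Data.List.Relation.Unary.Any using (Any; here)
open import Data.Nat using (ℕ; zero; suc; _≤_)
open import Data.Nat.Properties using (1+n≰n)
open import Data.Product using (∃; ∃-syntax; _×_; _,_)
open import Data.Sum using (_⊎_; inj₁; inj₂)
open import Data.Vec using (Vec; []; _∷_; lookup; map; insertAt; _[_]≔_; toList)
open import Data.Vec.Membership.Propositional using (_∈_; _∉_)
open import Data.Vec.Membership.Propositional.Properties using (∈-lookup)
open import Data.Vec.Properties using (≡-dec; lookup∘update′)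
import Data.Vec.Membership.DecPropositional as DecMembership
import Data.Vec.Relation.Unary.All as VecAll
import Data.Vec.Relation.Unary.Any as VecAny
open import Data.Vec.Relation.Unary.AllPairs using (AllPairs; []; _∷_; allPairs?)
open import Data.Vec.Relation.Unary.Unique.Propositional using (Unique)
open import Data.Vec.Relation.Unary.Unique.Propositional.Properties using (lookup-injective)
open import Function using (id; _∘_)
open import Relation.Binary.PropositionalEquality using (_≡_; _≢_; refl; sym; trans; subst; ≢-sym)
open import Relation.Nullary using (Dec; yes; no; ¬_; ¬?; contradiction)
open import Relation.Nullary.Decidable using (map′; _×-dec_)
open import Relation.Unary using (Pred; Decidable)
open import Level using (0ℓ)

private
  variable
    k l m n : ℕ

-- The set [n] is represented by Fin n (so j ∈ [n] is the element j ∸ 1), and a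
-- permutation of [n] by its one-line notation, a repetition-free Vec (Fin n) n.

words : (n m : ℕ) → List (Vec (Fin n) m)
words n zero    = [] ∷ []
words n (suc m) = cartesianProductWith _∷_ (allFin n) (words n m)

unique? : Decidable (Unique {A = Fin n} {m})
unique? = allPairs? λ x y → ¬? (x ≟ y)

𝒮 : (n : ℕ) → List (Vec (Fin n) n)
𝒮 n = filter unique? (words n n)

Lmax : Vec (Fin n) m → Pred (Fin n) 0ℓ
Lmax w v = ∃[ i ] lookup w i ≡ v × (∀ j → j < i → lookup w j < lookup w i)

-- continueCycle a w splits w into the remainder of the cycle opened by a, and the
-- cycles after it.  The opening entry a is the latest left-to-right maximum, hence
-- the largest entry so far, so the next entry exceeding a is the next
-- left-to-right maximum.
continueCycle : Fin n → List (Fin n) → List (Fin n) × List (List (Fin n))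
continueCycle a []      = [] , []
continueCycle a (b ∷ w) with a <? b
... | yes _ = let (c , cs) = continueCycle b w in [] , (b ∷ c) ∷ cs
... | no  _ = let (c , cs) = continueCycle a w in b ∷ c , cs

cycleForm : List (Fin n) → List (List (Fin n))
cycleForm []      = []
cycleForm (a ∷ w) = let (c , cs) = continueCycle a w in (a ∷ c) ∷ cs

-- ⟦ c₁ ∷ … ∷ cₛ ∷ [] ⟧ is the cycle c₁ ↦ c₂ ↦ … ↦ cₛ ↦ c₁, fixing everything else.
⟦_⟧ : List (Fin n) → Fin n → Fin n
⟦ []     ⟧ x = x
⟦ c₁ ∷ c ⟧ x = next c₁ c
  where
  next : Fin _ → List (Fin _) → Fin _
  next a [] with x ≟ a
  ... | yes _ = c₁
  ... | no  _ = x
  next a (b ∷ c) with x ≟ a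
  ... | yes _ = b
  ... | no  _ = next b c

-- The cycles are disjoint, so the order of composition is immaterial.
hat : Vec (Fin n) n → Fin n → Fin n
hat π = foldr (λ c f → ⟦ c ⟧ ∘ f) id (cycleForm (toList π))

-- Arrow patterns of size k; an arrow b → c is the pair (b , c).
record ArrowPattern (k : ℕ) : Set where
  constructor arrowPattern
  field
    {len}    : ℕ
    word     : Vec (Fin k) len
    arrows   : List (Fin k × Fin k)
    distinct : Unique word
    covers   : ∀ j → j ∈ word ⊎ Any (λ (b , c) → j ≡ b ⊎ j ≡ c) arrows

Increasing : Vec (Fin n) m → Set
Increasing = AllPairs _<_

-- x lists the set X in increasing order, and t the positions of the occurrence.
Occurs : Vec (Fin n) n → (α : ArrowPattern k) →
         Vec (Fin n) k → Vec (Fin n) (ArrowPattern.len α) → Set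
Occurs π α x t =
    Increasing x
  × Increasing t
  × map (lookup π) t ≡ map (lookup x) word
  × All (λ (b , c) → hat π (lookup x b) ≡ lookup x c) arrows
  where open ArrowPattern α

Contains : Vec (Fin n) n → ArrowPattern k → Set
Contains π α = ∃[ x ] ∃[ t ] Occurs π α x t

Avoids : ArrowPattern k → Vec (Fin n) n → Set
Avoids α π = ¬ Contains π α

anyVec? : {P : Pred (Vec (Fin n) m) 0ℓ} → Decidable P → Dec (∃ P)
anyVec? {m = zero}  P? = map′ ([] ,_) (λ { ([] , p) → p }) (P? [])
anyVec? {m = suc m} P? =
  map′ (λ (a , v , p) → a ∷ v , p) (λ { (a ∷ v , p) → a , v , p })
       (any? λ a → anyVec? λ v → P? (a ∷ v))

contains? : (π : Vec (Fin n) n) (α : ArrowPattern k) → Dec (Contains π α)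
contains? π α = anyVec? λ x → anyVec? λ t →
        allPairs? _<?_ x
  ×-dec allPairs? _<?_ t
  ×-dec ≡-dec _≟_ (map (lookup π) t) (map (lookup x) word)
  ×-dec all? (λ (b , c) → hat π (lookup x b) ≟ lookup x c) arrows
  where open ArrowPattern α

avoids? : (α : ArrowPattern k) → Decidable (Avoids {n = n} α)
avoids? α π = ¬? (contains? π α)

𝒮-avoiding : (n : ℕ) → ArrowPattern k → List (Vec (Fin n) n)
𝒮-avoiding n α = filter (avoids? α) (𝒮 n)

infix 4 _∼_

-- As 𝒮 n has no repeated entries, the lengths are cardinalities.
_∼_ : ArrowPattern k → ArrowPattern l → Set
α ∼ β = ∀ n → 1 ≤ n → length (𝒮-avoiding n α) ≡ length (𝒮-avoiding n β)

private
  All-≔ : ∀ {A : Set} {P : Pred A 0ℓ} {v : A} {xs : Vec A m} →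
          VecAll.All P xs → P v → ∀ i → VecAll.All P (xs [ i ]≔ v)
  All-≔ (p VecAll.∷ ps) q zero    = q VecAll.∷ ps
  All-≔ (p VecAll.∷ ps) q (suc i) = p VecAll.∷ All-≔ ps q i

  All-insertAt : ∀ {A : Set} {P : Pred A 0ℓ} {v : A} {xs : Vec A m} →
                 VecAll.All P xs → P v → ∀ i → VecAll.All P (insertAt xs i v)
  All-insertAt ps              q zero    = q VecAll.∷ ps
  All-insertAt (p VecAll.∷ ps) q (suc i) = p VecAll.∷ All-insertAt ps q i

  ∉⇒All-≢ : ∀ {A : Set} {v : A} (xs : Vec A m) → v ∉ xs → VecAll.All (v ≢_) xs
  ∉⇒All-≢ []       v∉ = VecAll.[]
  ∉⇒All-≢ (x ∷ xs) v∉ =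
    (v∉ ∘ VecAny.here) VecAll.∷ ∉⇒All-≢ xs (v∉ ∘ VecAny.there)

  lookup-index : ∀ {A : Set} {v : A} {xs : Vec A m} (v∈ : v ∈ xs) →
                 v ≡ lookup xs (VecAny.index v∈)
  lookup-index (VecAny.here  eq) = eq
  lookup-index (VecAny.there v∈) = lookup-index v∈

  unique⇒full : {w : Vec (Fin k) k} → Unique w → ∀ j → j ∈ w
  unique⇒full {w = w} w! j with DecMembership._∈?_ _≟_ j w
  ... | yes j∈w = j∈w
  ... | no  j∉w = contradiction
    (injective⇒≤ (lookup-injective (∉⇒All-≢ w j∉w ∷ w!) _ _)) 1+n≰n

replace-unique : {ν : Vec (Fin k) m} → Unique ν → ∀ {r} → r ∉ ν →
                 ∀ i → Unique (ν [ i ]≔ r)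
replace-unique {ν = v ∷ ν} (_  ∷ ν!) r∉ zero    = ∉⇒All-≢ ν (r∉ ∘ VecAny.there) ∷ ν!
replace-unique {ν = v ∷ ν} (v∉ ∷ ν!) r∉ (suc i) =
  All-≔ v∉ (≢-sym (r∉ ∘ VecAny.here)) i ∷ replace-unique ν! (r∉ ∘ VecAny.there) i

insert-unique : {ν : Vec (Fin k) m} → Unique ν → ∀ {r} → r ∉ ν →
                ∀ i → Unique (insertAt ν i r)
insert-unique {ν = ν}     ν!        r∉ zero    = ∉⇒All-≢ ν r∉ ∷ ν!
insert-unique {ν = v ∷ ν} (v∉ ∷ ν!) r∉ (suc i) =
  All-insertAt v∉ (≢-sym (r∉ ∘ VecAny.here)) i ∷ insert-unique ν! (r∉ ∘ VecAny.there) i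

module _ {ν : Vec (Fin (suc m)) m} (ν! : Unique ν) {r : Fin (suc m)} (r∉ν : r ∉ ν) where

  private
    Covers : Fin m → Vec (Fin (suc m)) l → Set
    Covers i w = ∀ j → j ∈ w ⊎ Any (λ (b , c) → j ≡ b ⊎ j ≡ c) ((r , lookup ν i) ∷ [])

  word-covers : ∀ i → Covers i ν
  word-covers i j with unique⇒full (∉⇒All-≢ ν r∉ν ∷ ν!) j
  ... | VecAny.here  j≡r = inj₂ (here (inj₁ j≡r))
  ... | VecAny.there j∈ν = inj₁ j∈ν

  replace-covers : ∀ i → Covers i (ν [ i ]≔ r)
  replace-covers i j with word-covers i j
  ... | inj₂ j∈H = inj₂ j∈H
  ... | inj₁ j∈ν with VecAny.index j∈ν ≟ i | lookup-index j∈ν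
  ...   | yes refl | eq = inj₂ (here (inj₂ eq))
  ...   | no  p≢i  | eq = inj₁ (subst (_∈ (ν [ i ]≔ r))
    (trans (lookup∘update′ p≢i ν r) (sym eq))
    (∈-lookup (VecAny.index j∈ν) (ν [ i ]≔ r)))

  insert-covers : ∀ i → Covers i (insertAt ν (inject₁ i) r)
  insert-covers i j = inj₁ (unique⇒full (insert-unique ν! r∉ν (inject₁ i)) j)

{-# OPTIONS --safe #-}
module Submission where

-- Under the hypothesis the three patterns are contained in exactly the same permutations.
-- By the construction of hat π, an arrow x → y with x ≢ y either has y immediately after x
-- in π, or y is a left-to-right maximum that dominates π up to and including x.  In the
-- second case x < y, and no entry to the left of x or of y exceeds y; this is impossible if
-- r > νᵢ or if ν has an entry larger than νᵢ to the left of νᵢ.  So x_r stands immediately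
-- before x_νᵢ in π, and an occurrence that uses one of these two entries extends to one that
-- uses both.  Conversely, dropping either of them from an occurrence of the long word gives
-- occurrences of the other two words.

open import Defs
open import Data.Empty using (⊥)
open import Data.Fin using (Fin; zero; suc; toℕ; _<_; _≤_; inject₁)
open import Data.Fin.Properties using (_≟_; _<?_; ≤-refl; ≤-trans; <-trans; <-cmp; <⇒≢; toℕ-injective; ¬∀⟶∃¬)
open import Data.List using (List; []; _∷_; _++_; concat; filter; foldr; length)
open import Data.List.Membership.Propositional using () renaming (_∈_ to _∈ₗ_)
open import Data.List.Membership.Propositional.Properties using (∈-++⁺ˡ; ∈-++⁺ʳ)
open import Data.List.Properties using (filter-accept; filter-reject)
open import Data.List.Relation.Unary.All as ListAll using ()
import Data.List.Relation.Unary.All.Properties as ListAll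
open import Data.List.Relation.Unary.AllPairs as ListAllPairs using ()
open import Data.List.Relation.Unary.Any as ListAny using (Any; here; there)
open import Data.List.Relation.Unary.Any.Properties using (Any-⊎⁻)
open import Data.List.Relation.Unary.Unique.Propositional using () renaming (Unique to Uniqueₗ)
open import Data.Nat using (ℕ; suc; s≤s; s≤s⁻¹)
import Data.Nat.Properties as ℕ
open import Data.Product using (∃-syntax; ∃₂; _×_; _,_)
open import Data.Sum using (_⊎_; inj₁; inj₂)
import Data.Sum as Sum
open import Data.Vec using (Vec; []; _∷_; lookup; map; insertAt; removeAt; toList; _[_]≔_)
open import Data.Vec.Membership.Propositional using (_∈_; _∉_)
open import Data.Vec.Membership.Propositional.Properties using (∈-lookup)
open import Data.Vec.Properties using (lookup-map; map-insertAt; lookup∘update; lookup∘update′; removeAt-insertAt)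
open import Data.Vec.Relation.Unary.All as All using (All; []; _∷_)
import Data.Vec.Relation.Unary.All.Properties as All
open import Data.Vec.Relation.Unary.AllPairs as AllPairs using (AllPairs; []; _∷_)
open import Data.Vec.Relation.Unary.Any as Any using (here; there)
open import Data.Vec.Relation.Unary.Any.Properties using (lookup-index)
open import Data.Vec.Relation.Unary.Unique.Propositional using (Unique)
open import Data.Vec.Relation.Unary.Unique.Propositional.Properties using (lookup-injective)
open import Function using (_∘_; id)
open import Level using (0ℓ)
open import Relation.Binary using (Rel; tri<; tri≈; tri>)
open import Relation.Binary.PropositionalEquality using (_≡_; _≢_; refl; sym; trans; cong; cong₂; subst; module ≡-Reasoning)
open import Relation.Nullary using (¬_; yes; no; contradiction)
open import Relation.Nullary.Decidable using (_→-dec_)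
open import Relation.Unary using (Pred; Decidable)

private
  variable
    k l m n : ℕ
    A : Set
    x y a b : Fin n
    w : List (Fin n)

-- Single steps of a cycle.

data Adjacent {A : Set} (x y : A) : List A → Set where
  here  : ∀ {w} → Adjacent x y (x ∷ y ∷ w)
  there : ∀ {z w} → Adjacent x y w → Adjacent x y (z ∷ w)

-- For a repetition-free cycle form, the last entry x of a cycle returns to its first entry y;
-- the weaker membership x ∈ₗ y ∷ c suffices for the domination argument.
data Closing {A : Set} (x y : A) : List A → Set where
  closing : ∀ {c} → x ∈ₗ y ∷ c → Closing x y (y ∷ c)

CycleStep : A → A → List A → Set
CycleStep x y c = Adjacent x y c ⊎ Closing x y c

adjacent-∈ˡ : {x y : A} {w : List A} → Adjacent x y w → x ∈ₗ w
adjacent-∈ˡ here      = here refl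
adjacent-∈ˡ (there p) = there (adjacent-∈ˡ p)

adjacent-∈ʳ : {x y : A} {w : List A} → Adjacent x y w → y ∈ₗ w
adjacent-∈ʳ here      = there (here refl)
adjacent-∈ʳ (there p) = there (adjacent-∈ʳ p)

adjacent-++⁺ˡ : {x y : A} {u : List A} (v : List A) → Adjacent x y u → Adjacent x y (u ++ v)
adjacent-++⁺ˡ v here      = here
adjacent-++⁺ˡ v (there p) = there (adjacent-++⁺ˡ v p)

adjacent-++⁺ʳ : {x y : A} (u : List A) {v : List A} → Adjacent x y v → Adjacent x y (u ++ v)
adjacent-++⁺ʳ []      p = p
adjacent-++⁺ʳ (_ ∷ u) p = there (adjacent-++⁺ʳ u p)

step-∈ˡ : {x y : A} {c : List A} → CycleStep x y c → x ∈ₗ c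
step-∈ˡ (inj₁ p)           = adjacent-∈ˡ p
step-∈ˡ (inj₂ (closing p)) = p

step-∈ʳ : {x y : A} {c : List A} → CycleStep x y c → y ∈ₗ c
step-∈ʳ (inj₁ p)           = adjacent-∈ʳ p
step-∈ʳ (inj₂ (closing _)) = here refl

steps-∈ʳ : {x y : A} {cs : List (List A)} → Any (CycleStep x y) cs → y ∈ₗ concat cs
steps-∈ʳ (here p)             = ∈-++⁺ˡ (step-∈ʳ p)
steps-∈ʳ {cs = c ∷ _} (there p) = ∈-++⁺ʳ c (steps-∈ʳ p)

-- nextIn is the function next local to ⟦_⟧, which has no name outside Defs.  It is the
-- solution of the metavariable below, determined by the last clause of ⟦⟧-unfold.
mutual
  nextIn : Fin n → List (Fin n) → Fin n → Fin n → List (Fin n) → Fin n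
  nextIn = _

  ⟦⟧-unfold : ∀ (c₁ b : Fin n) c x → x ≢ c₁ → ⟦ c₁ ∷ b ∷ c ⟧ x ≡ nextIn c₁ (b ∷ c) x b c
  ⟦⟧-unfold c₁ b c x x≢c₁ with x ≟ c₁
  ... | yes x≡c₁ = contradiction x≡c₁ x≢c₁
  -- Generalising `b ∷ c` makes the arguments of `nextIn` distinct variables, so the equation has
  -- exactly one solution.
  ... | no  _ with b ∷ c
  ...   | _ = refl

nextIn-step : ∀ (c₁ : Fin n) cs x a c → let y = nextIn c₁ cs x a c in
              y ≡ x ⊎ Adjacent x y (a ∷ c) ⊎ (x ∈ₗ a ∷ c × y ≡ c₁)
nextIn-step c₁ cs x a [] with x ≟ a
... | yes x≡a = inj₂ (inj₂ (here x≡a , refl))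
... | no  _   = inj₁ refl
nextIn-step c₁ cs x a (b ∷ c) with x ≟ a
... | yes refl = inj₂ (inj₁ here)
... | no  _    = Sum.map₂ (Sum.map there λ (x∈ , eq) → there x∈ , eq) (nextIn-step c₁ cs x b c)

⟦⟧-step : ∀ (c : List (Fin n)) x → ⟦ c ⟧ x ≡ x ⊎ CycleStep x (⟦ c ⟧ x) c
⟦⟧-step []       x = inj₁ refl
⟦⟧-step (c₁ ∷ c) x with nextIn-step c₁ c x c₁ c
... | inj₁ eq               = inj₁ eq
... | inj₂ (inj₁ p)         = inj₂ (inj₁ p)
... | inj₂ (inj₂ (x∈ , eq)) = inj₂ (inj₂ (subst (λ y → Closing x y (c₁ ∷ c)) (sym eq) (closing x∈)))

-- Products of disjoint cycles.

unique-++⁻ʳ : (u : List A) {v : List A} → Uniqueₗ (u ++ v) → Uniqueₗ v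
unique-++⁻ʳ []      v!                    = v!
unique-++⁻ʳ (_ ∷ u) (_ ListAllPairs.∷ uv!) = unique-++⁻ʳ u uv!

unique-++⇒disjoint : (u : List A) {v : List A} {x : A} → Uniqueₗ (u ++ v) → x ∈ₗ u → x ∈ₗ v → ⊥
unique-++⇒disjoint (_ ∷ u) (x≢ ListAllPairs.∷ _)   (here refl) x∈v =
  ListAll.lookup x≢ (∈-++⁺ʳ u x∈v) refl
unique-++⇒disjoint (_ ∷ u) (_  ListAllPairs.∷ uv!) (there x∈u) x∈v =
  unique-++⇒disjoint u uv! x∈u x∈v

-- The head cycle acts last. A value reached by a step in a later cycle lies outside the head cycle
-- by disjointness, so the head cycle fixes it.
cycles-step : ∀ (cs : List (List (Fin n))) → Uniqueₗ (concat cs) → ∀ x →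
              let y = foldr (λ c f → ⟦ c ⟧ ∘ f) id cs x in y ≡ x ⊎ Any (CycleStep x y) cs
cycles-step []       _   x = inj₁ refl
cycles-step (c ∷ cs) cs! x with cycles-step cs (unique-++⁻ʳ c cs!) x
... | inj₁ eq rewrite eq = Sum.map₂ here (⟦⟧-step c x)
... | inj₂ p with foldr (λ c f → ⟦ c ⟧ ∘ f) id cs x
...   | z with ⟦⟧-step c z
...     | inj₁ eq rewrite eq = inj₂ (there p)
...     | inj₂ q             = contradiction (steps-∈ʳ p) (unique-++⇒disjoint c cs! (step-∈ˡ q))

-- Cycle forms and left-to-right maxima.

continueCycle-concat : ∀ (a : Fin n) w → let (c , cs) = continueCycle a w in c ++ concat cs ≡ w
continueCycle-concat a []      = refl
continueCycle-concat a (b ∷ w) with a <? b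
... | yes _ = cong (b ∷_) (continueCycle-concat b w)
... | no  _ = cong (b ∷_) (continueCycle-concat a w)

cycleForm-concat : ∀ (w : List (Fin n)) → concat (cycleForm w) ≡ w
cycleForm-concat []      = refl
cycleForm-concat (a ∷ w) = cong (a ∷_) (continueCycle-concat a w)

data Below (x y : Fin n) : List (Fin n) → Set where
  here  : ∀ {w} → x ≤ y → Below x y (x ∷ w)
  there : ∀ {z w} → z ≤ y → Below x y w → Below x y (z ∷ w)

below-head : Below x y (a ∷ w) → a ≤ y
below-head (here  a≤y)   = a≤y
below-head (there a≤y _) = a≤y

-- `continueCycle` keeps the opening entry `a` while passing over an entry `b` that does not exceed
-- it; the recursive result for `a ∷ w` must then take `b` back in.
below-insert : b ≤ a → Below x y (a ∷ w) → Below x y (a ∷ b ∷ w)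
below-insert b≤a (here  a≤y)   = here a≤y
below-insert b≤a (there a≤y p) = there a≤y (there (≤-trans b≤a a≤y) p)

-- Opening entries increase from cycle to cycle and bound the entries of their own cycles, so the
-- opening entry `y` bounds everything before its cycle and within it.
continueCycle-below : ∀ (a : Fin n) w → let (c , cs) = continueCycle a w in
                      Any (Closing x y) ((a ∷ c) ∷ cs) → Below x y (a ∷ w)
continueCycle-below a [] (here (closing (here refl))) = here ≤-refl
continueCycle-below a (b ∷ w) p with a <? b
continueCycle-below a (b ∷ w) (here (closing (here refl))) | yes _ = here ≤-refl
continueCycle-below a (b ∷ w) (there p) | yes a<b =
  let q = continueCycle-below b w p in there (≤-trans (ℕ.<⇒≤ a<b) (below-head q)) q
continueCycle-below a (b ∷ w) (here (closing (here refl))) | no _ = here ≤-refl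
continueCycle-below a (b ∷ w) (here (closing (there (here refl)))) | no a≮b =
  there ≤-refl (here (ℕ.≮⇒≥ a≮b))
continueCycle-below a (b ∷ w) (here (closing (there (there x∈c)))) | no a≮b =
  below-insert (ℕ.≮⇒≥ a≮b) (continueCycle-below a w (here (closing (there x∈c))))
continueCycle-below a (b ∷ w) (there p) | no a≮b =
  below-insert (ℕ.≮⇒≥ a≮b) (continueCycle-below a w (there p))

cycleForm-below : ∀ (w : List (Fin n)) → Any (Closing x y) (cycleForm w) → Below x y w
cycleForm-below (a ∷ w) = continueCycle-below a w

closing-head : {x y : A} {c : List A} → Closing x y c → Closing y y c
closing-head (closing _) = closing (here refl)

adjacent-concat⁺ : {x y : A} {cs : List (List A)} → Any (Adjacent x y) cs → Adjacent x y (concat cs)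
adjacent-concat⁺ {cs = c ∷ cs} (here p)  = adjacent-++⁺ˡ (concat cs) p
adjacent-concat⁺ {cs = c ∷ cs} (there p) = adjacent-++⁺ʳ c (adjacent-concat⁺ p)

toList-unique : {w : Vec A m} → Unique w → Uniqueₗ (toList w)
toList-unique []         = ListAllPairs.[]
toList-unique (w≢ ∷ w!) = All.toList⁺ w≢ ListAllPairs.∷ toList-unique w!

-- Arrows in terms of positions in the one-line notation.

ConsecutiveIn : Vec (Fin n) m → Fin n → Fin n → Set
ConsecutiveIn w x y = ∃₂ λ p q → toℕ q ≡ suc (toℕ p) × lookup w p ≡ x × lookup w q ≡ y

DominatedUpTo : Vec (Fin n) m → Fin n → Fin n → Set
DominatedUpTo w x y = ∃[ p ] lookup w p ≡ x × (∀ j → j ≤ p → lookup w j ≤ y)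

adjacent⇒consecutive : ∀ (w : Vec (Fin n) m) → Adjacent x y (toList w) → ConsecutiveIn w x y
adjacent⇒consecutive (_ ∷ _ ∷ _) here      = zero , suc zero , refl , refl , refl
adjacent⇒consecutive (_ ∷ w)     (there p) =
  let (p , q , q≡1+p , eqs) = adjacent⇒consecutive w p in suc p , suc q , cong suc q≡1+p , eqs

below⇒dominated : ∀ (w : Vec (Fin n) m) → Below x y (toList w) → DominatedUpTo w x y
below⇒dominated (_ ∷ _) (here x≤y)    = zero , refl , λ { zero _ → x≤y }
below⇒dominated (_ ∷ w) (there z≤y p) =
  let (p , eq , dom) = below⇒dominated w p
  in suc p , eq , λ { zero _ → z≤y ; (suc j) (s≤s j≤p) → dom j j≤p }

-- Removing the parentheses of the cycle form restores `π`, so adjacency in a cycle is adjacency in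
-- `π`. A closing step is covered by `cycleForm-below`, used once for `x` and once for `y`.
hat-step : ∀ (π : Vec (Fin n) n) → Unique π → hat π x ≡ y → x ≢ y →
           ConsecutiveIn π x y ⊎ (DominatedUpTo π x y × DominatedUpTo π y y)
hat-step {x = x} π π! refl x≢y with
  cycles-step (cycleForm (toList π))
    (subst Uniqueₗ (sym (cycleForm-concat (toList π))) (toList-unique π!)) x
... | inj₁ y≡x = contradiction (sym y≡x) x≢y
... | inj₂ p with Any-⊎⁻ p
...   | inj₁ q = inj₁ (adjacent⇒consecutive π
  (subst (Adjacent _ _) (cycleForm-concat (toList π)) (adjacent-concat⁺ q)))
...   | inj₂ q = inj₂ ( below⇒dominated π (cycleForm-below (toList π) q)
                      , below⇒dominated π (cycleForm-below (toList π) (ListAny.map closing-head q)))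

-- Occurrences and forced adjacency.

increasing-mono : {x : Vec (Fin n) m} → Increasing x → ∀ {i j} → i < j → lookup x i < lookup x j
increasing-mono {x = _ ∷ x} (x< ∷ _)  {zero}  {suc j} _         = All.lookup⁺ x< j
increasing-mono {x = _ ∷ _} (_  ∷ x↑) {suc i} {suc j} (s≤s i<j) = increasing-mono x↑ i<j

increasing-injective : {x : Vec (Fin n) m} → Increasing x → ∀ i j → lookup x i ≡ lookup x j → i ≡ j
increasing-injective = lookup-injective ∘ AllPairs.map <⇒≢

-- Either alternative keeps b → c from being matched by an arrow that closes a cycle of hat π.
ArrowForcesAdjacency : Vec (Fin k) l → Fin k → Fin k → Set
ArrowForcesAdjacency w b c =
  c < b ⊎ (∃₂ λ j i → j < i × c < lookup w j × (lookup w i ≡ b ⊎ lookup w i ≡ c))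

module _ (π : Vec (Fin n) n) (x : Vec (Fin n) k) {w : Vec (Fin k) l} {t}
         (eq : map (lookup π) t ≡ map (lookup x) w) where

  match-lookup : ∀ j → lookup π (lookup t j) ≡ lookup x (lookup w j)
  match-lookup j = begin
    lookup π (lookup t j)       ≡⟨ lookup-map j (lookup π) t ⟨
    lookup (map (lookup π) t) j ≡⟨ cong (λ v → lookup v j) eq ⟩
    lookup (map (lookup x) w) j ≡⟨ lookup-map j (lookup x) w ⟩
    lookup x (lookup w j)       ∎
    where open ≡-Reasoning

  -- The values are distinct, so a chosen position carrying `x_b` would put `b` into `w`. This keeps
  -- an inserted position new.
  match-∉ : Increasing x → ∀ {b p} → b ∉ w → lookup π p ≡ lookup x b → p ∉ t
  match-∉ x↑ {b} b∉w eq′ p∈t = b∉w (subst (_∈ w) w≡b (∈-lookup j w))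
    where
    j   = Any.index p∈t
    w≡b = increasing-injective x↑ _ b
      (trans (sym (match-lookup j)) (trans (cong (lookup π) (sym (lookup-index p∈t))) eq′))

  -- A closing arrow bounds by `x_c` every entry of `π` up to `x_b` and up to `x_c`. The first
  -- alternative contradicts this at `x_b` itself, the second at the match of the larger entry
  -- `w_j`, which stands to the left of `x_b` or `x_c`.
  arrow-consecutive : Unique π → Increasing x → Increasing t → ∀ {b c} →
    hat π (lookup x b) ≡ lookup x c → b ≢ c →
    ArrowForcesAdjacency w b c →
    ConsecutiveIn π (lookup x b) (lookup x c)
  arrow-consecutive π! x↑ t↑ {b} {c} arrow b≢c h
    with hat-step π π! arrow (b≢c ∘ increasing-injective x↑ b c)
  ... | inj₁ consecutive = consecutive
  ... | inj₂ (b-dom@(p , π[p]≡ , dom) , c-dom) = contradiction h λ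
    { (inj₁ c<b) → ℕ.<⇒≱ (increasing-mono x↑ c<b) (subst (_≤ lookup x c) π[p]≡ (dom p ≤-refl))
    ; (inj₂ (j , i , j<i , c<w[j] , inj₁ refl)) → not-dominated j<i c<w[j] b-dom
    ; (inj₂ (j , i , j<i , c<w[j] , inj₂ refl)) → not-dominated j<i c<w[j] c-dom
    }
    where
    not-dominated : ∀ {i j d} → j < i → d < lookup w j →
                    ¬ DominatedUpTo π (lookup x (lookup w i)) (lookup x d)
    not-dominated {i} {j} {d} j<i d<w[j] (p , π[p]≡ , dom)
      with lookup-injective π! p (lookup t i) (trans π[p]≡ (sym (match-lookup i)))
    ... | refl = ℕ.<⇒≱ (increasing-mono x↑ d<w[j])
      (subst (_≤ lookup x d) (match-lookup j) (dom (lookup t j) (ℕ.<⇒≤ (increasing-mono t↑ j<i))))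

-- Deletion and insertion in increasing words.

map-removeAt : ∀ {A B : Set} (f : A → B) (xs : Vec A (suc m)) i →
               map f (removeAt xs i) ≡ removeAt (map f xs) i
map-removeAt f (_ ∷ _)          zero    = refl
map-removeAt f (x ∷ xs@(_ ∷ _)) (suc i) = cong (f x ∷_) (map-removeAt f xs i)

all-removeAt : {P : Pred A 0ℓ} {xs : Vec A (suc m)} → All P xs → ∀ i → All P (removeAt xs i)
all-removeAt (_ ∷ ps)         zero    = ps
all-removeAt (p ∷ ps@(_ ∷ _)) (suc i) = p ∷ all-removeAt ps i

allPairs-removeAt : {R : Rel A 0ℓ} {xs : Vec A (suc m)} → AllPairs R xs →
                    ∀ i → AllPairs R (removeAt xs i)
allPairs-removeAt (_ ∷ ps)         zero    = ps
allPairs-removeAt (p ∷ ps@(_ ∷ _)) (suc i) = all-removeAt p i ∷ allPairs-removeAt ps i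

all-insertAt : {P : Pred A 0ℓ} {a : A} {xs : Vec A m} → All P xs → P a →
               ∀ i → All P (insertAt xs i a)
all-insertAt ps       q zero    = q ∷ ps
all-insertAt (p ∷ ps) q (suc i) = p ∷ all-insertAt ps q i

module _ {p q : Fin n} (q≡1+p : toℕ q ≡ suc (toℕ p)) where

  pred< : p < q
  pred< = ℕ.≤-reflexive (sym q≡1+p)

  -- No integer lies strictly between `p` and `q`: an entry below `q` is at most `p`, and differs
  -- from `p` because `p ∉ t`.
  insert-pred : {t : Vec (Fin n) m} → Increasing t → p ∉ t → ∀ i → lookup t i ≡ q →
                Increasing (insertAt t (inject₁ i) p)
  insert-pred (q<t ∷ t↑) _ zero refl = (pred< ∷ All.map (<-trans {i = p} pred<) q<t) ∷ q<t ∷ t↑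
  insert-pred {t = h ∷ t} (h<t ∷ t↑) p∉ (suc i) refl =
    all-insertAt h<t h<p (inject₁ i) ∷ insert-pred t↑ (p∉ ∘ there) i refl
    where
    h<p : h < p
    h<p = ℕ.≤∧≢⇒< (s≤s⁻¹ (ℕ.≤-trans (All.lookup⁺ h<t i) (ℕ.≤-reflexive q≡1+p)))
                  (p∉ ∘ here ∘ sym ∘ toℕ-injective)

  -- Mirror image: an entry above `p` is at least `q`, and differs from `q` because `q ∉ t`.
  insert-succ : {t : Vec (Fin n) m} → Increasing t → q ∉ t → ∀ i → lookup t i ≡ p →
                Increasing (insertAt t (suc i) q)
  insert-succ {t = _ ∷ t} (p<t ∷ t↑) q∉ zero refl = (pred< ∷ p<t) ∷ q<t ∷ t↑
    where
    q<t : All (q <_) t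
    q<t = All.lookup⁻ λ j → ℕ.≤∧≢⇒< (ℕ.≤-trans (ℕ.≤-reflexive q≡1+p) (All.lookup⁺ p<t j))
      (λ eq → q∉ (there (subst (_∈ t) (sym (toℕ-injective eq)) (∈-lookup j t))))
  insert-succ (h<t ∷ t↑) q∉ (suc i) refl =
    all-insertAt h<t (<-trans (All.lookup⁺ h<t i) pred<) (suc i) ∷ insert-succ t↑ (q∉ ∘ there) i refl

-- Shortening and extending occurrences.

-- An occurrence for a single arrow, indexed by the bare word: it can be transported along word
-- identities without the `distinct` and `covers` proofs.
record Matches (π : Vec (Fin n) n) (b c : Fin k) (w : Vec (Fin k) l) : Set where
  constructor matching
  field
    values        : Vec (Fin n) k
    positions     : Vec (Fin n) l
    values-↑      : Increasing values
    positions-↑   : Increasing positions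
    word-matches  : map (lookup π) positions ≡ map (lookup values) w
    arrow-matches : hat π (lookup values b) ≡ lookup values c

open ArrowPattern

module _ {π : Vec (Fin n) n} {b c : Fin k} (α : ArrowPattern k) (arrows≡ : arrows α ≡ (b , c) ∷ []) where

  matches⇒contains : Matches π b c (word α) → Contains π α
  matches⇒contains (matching x t x↑ t↑ eq arrow) =
    x , t , x↑ , t↑ , eq , subst (ListAll.All _) (sym arrows≡) (arrow ListAll.∷ ListAll.[])

  contains⇒matches : Contains π α → Matches π b c (word α)
  contains⇒matches (x , t , x↑ , t↑ , eq , arrow) =
    matching x t x↑ t↑ eq (ListAll.head (subst (ListAll.All _) arrows≡ arrow))

map-insertAt-cong : ∀ {B C : Set} {f : A → C} {g : B → C} {xs : Vec A m} {ys : Vec B m} {a b} →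
                    map f xs ≡ map g ys → f a ≡ g b → ∀ i →
                    map f (insertAt xs i a) ≡ map g (insertAt ys i b)
map-insertAt-cong {f = f} {g} {xs} {ys} {a} {b} eq fa≡gb i = begin
  map f (insertAt xs i a)     ≡⟨ map-insertAt f a xs i ⟩
  insertAt (map f xs) i (f a) ≡⟨ cong₂ (λ v → insertAt v i) eq fa≡gb ⟩
  insertAt (map g ys) i (g b) ≡⟨ map-insertAt g b ys i ⟨
  map g (insertAt ys i b)     ∎
  where open ≡-Reasoning

-- The arrow condition refers to the values alone, so forgetting one position leaves it intact.
matches-removeAt : ∀ {π : Vec (Fin n) n} {b c : Fin k} {w : Vec (Fin k) (suc l)} →
                   Matches π b c w → ∀ i → Matches π b c (removeAt w i)
matches-removeAt {π = π} {w = w} (matching x t x↑ t↑ eq arrow) i =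
  matching x (removeAt t i) x↑ (allPairs-removeAt t↑ i) eq′ arrow
  where
  open ≡-Reasoning
  eq′ = begin
    map (lookup π) (removeAt t i) ≡⟨ map-removeAt (lookup π) t i ⟩
    removeAt (map (lookup π) t) i ≡⟨ cong (λ v → removeAt v i) eq ⟩
    removeAt (map (lookup x) w) i ≡⟨ map-removeAt (lookup x) w i ⟨
    map (lookup x) (removeAt w i) ∎

module _ {π : Vec (Fin n) n} (π! : Unique π) {b c : Fin k} (b≢c : b ≢ c)
         {w : Vec (Fin k) l} (forces : ArrowForcesAdjacency w b c) where

  -- The forced adjacency supplies the position `p` just before the one matched to `c`; choosing `p`
  -- as well matches the new letter `b`.
  matches-insert-source : b ∉ w → ∀ i → lookup w i ≡ c →
                          Matches π b c w → Matches π b c (insertAt w (inject₁ i) b)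
  matches-insert-source b∉w i refl (matching x t x↑ t↑ eq arrow) =
    let (p , q , q≡1+p , π[p]≡ , π[q]≡) = arrow-consecutive π x eq π! x↑ t↑ arrow b≢c forces
        t[i]≡q = lookup-injective π! _ q (trans (match-lookup π x eq i) (sym π[q]≡))
    in matching x (insertAt t (inject₁ i) p) x↑
         (insert-pred q≡1+p t↑ (match-∉ π x eq x↑ b∉w π[p]≡) i t[i]≡q)
         (map-insertAt-cong eq π[p]≡ (inject₁ i)) arrow

  matches-insert-target : c ∉ w → ∀ i → lookup w i ≡ b →
                          Matches π b c w → Matches π b c (insertAt w (suc i) c)
  matches-insert-target c∉w i refl (matching x t x↑ t↑ eq arrow) =
    let (p , q , q≡1+p , π[p]≡ , π[q]≡) = arrow-consecutive π x eq π! x↑ t↑ arrow b≢c forces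
        t[i]≡p = lookup-injective π! _ p (trans (match-lookup π x eq i) (sym π[p]≡))
    in matching x (insertAt t (suc i) q) x↑
         (insert-succ q≡1+p t↑ (match-∉ π x eq x↑ c∉w π[q]≡) i t[i]≡p)
         (map-insertAt-cong eq π[q]≡ (suc i)) arrow

-- Relations between the three words.

-- The insertion pushes entry `i` one place to the right, and deleting it there leaves `a` in its
-- stead: the long word yields the replaced one.
removeAt-insertAt-suc : ∀ (xs : Vec A m) i a →
                        removeAt (insertAt xs (inject₁ i) a) (suc i) ≡ xs [ i ]≔ a
removeAt-insertAt-suc (_ ∷ _)          zero          a = refl
removeAt-insertAt-suc (_ ∷ _ ∷ _)      (suc zero)    a = refl
removeAt-insertAt-suc (x ∷ xs@(_ ∷ _)) (suc (suc i)) a =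
  cong (x ∷_) (removeAt-insertAt-suc xs (suc i) a)

insertAt-update : ∀ (xs : Vec A m) i a →
                  insertAt (xs [ i ]≔ a) (suc i) (lookup xs i) ≡ insertAt xs (inject₁ i) a
insertAt-update (_ ∷ _)  zero    a = refl
insertAt-update (x ∷ xs) (suc i) a = cong (x ∷_) (insertAt-update xs i a)

lookup-∉-update : {xs : Vec A m} → Unique xs → ∀ {a} → a ∉ xs → ∀ i → lookup xs i ∉ xs [ i ]≔ a
lookup-∉-update {xs = xs} xs! {a} a∉xs i x∈ with Any.index x∈ | lookup-index x∈
... | j | eq with j ≟ i
...   | yes refl = a∉xs (subst (_∈ xs) (trans eq (lookup∘update i xs a)) (∈-lookup i xs))
...   | no  j≢i  =
  j≢i (sym (lookup-injective xs! i _ (trans eq (lookup∘update′ j≢i xs a))))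

-- A decidable property that fails on finitely many positions has a counterexample;
-- repetition-freeness excludes equality there.
¬Lmax⇒larger : ∀ {w : Vec (Fin n) m} → Unique w → ∀ i → ¬ Lmax w (lookup w i) →
               ∃[ j ] j < i × lookup w i < lookup w j
¬Lmax⇒larger {w = w} w! i ¬max
  with ¬∀⟶∃¬ _ _ (λ j → (j <? i) →-dec (lookup w j <? lookup w i)) (λ max → ¬max (i , refl , max))
... | j , ¬smaller with j <? i
...   | no  j≮i = contradiction (λ j<i → contradiction j<i j≮i) ¬smaller
...   | yes j<i with <-cmp (lookup w j) (lookup w i)
...     | tri< w[j]<w[i] _ _ = contradiction (λ _ → w[j]<w[i]) ¬smaller
...     | tri≈ _ w[j]≡w[i] _ = contradiction (lookup-injective w! j i w[j]≡w[i]) (<⇒≢ j<i)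
...     | tri> _ _ w[i]<w[j] = j , j<i , w[i]<w[j]

-- From equal containment to equal counts.

length-filter-cong : {P Q : Pred A 0ℓ} (P? : Decidable P) (Q? : Decidable Q) {xs : List A} →
                     ListAll.All (λ x → (P x → Q x) × (Q x → P x)) xs →
                     length (filter P? xs) ≡ length (filter Q? xs)
length-filter-cong P? Q? ListAll.[] = refl
length-filter-cong P? Q? {x ∷ xs} ((f , g) ListAll.∷ fgs) with P? x
... | yes Px = trans (cong suc (length-filter-cong P? Q? fgs))
                     (cong length (sym (filter-accept Q? (f Px))))
... | no ¬Px = trans (length-filter-cong P? Q? fgs)
                     (cong length (sym (filter-reject Q? (¬Px ∘ g))))

matched-alike⇒∼ : ∀ {b c : Fin k} (α β : ArrowPattern k) →
  arrows α ≡ (b , c) ∷ [] → arrows β ≡ (b , c) ∷ [] →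
  (∀ {n} {π : Vec (Fin n) n} → Unique π →
    (Matches π b c (word α) → Matches π b c (word β)) ×
    (Matches π b c (word β) → Matches π b c (word α))) →
  α ∼ β
matched-alike⇒∼ α β α≡ β≡ alike n _ = length-filter-cong (avoids? α) (avoids? β)
  (ListAll.map (λ π! → let (f , g) = alike π! in
      -- Avoidance reverses the implications between occurrences.
      _∘ matches⇒contains α α≡ ∘ g ∘ contains⇒matches β β≡
    , _∘ matches⇒contains β β≡ ∘ f ∘ contains⇒matches α α≡)
    (ListAll.all-filter unique? (words n n)))

proposition2p3 : ∀ (m : ℕ) (ν : Vec (Fin (suc m)) m) (ν! : Unique ν)
  (r : Fin (suc m)) (r∉ν : r ∉ ν) (i : Fin m) →
  lookup ν i < r ⊎ ¬ Lmax ν (lookup ν i) →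
  let H = (r , lookup ν i) ∷ []
      α = arrowPattern ν H ν! (word-covers ν! r∉ν i)
      β = arrowPattern (ν [ i ]≔ r) H
            (replace-unique ν! r∉ν i) (replace-covers ν! r∉ν i)
      γ = arrowPattern (insertAt ν (inject₁ i) r) H
            (insert-unique ν! r∉ν (inject₁ i)) (insert-covers ν! r∉ν i)
  in (α ∼ β) × (β ∼ γ)
proposition2p3 m ν ν! r r∉ν i h =
    -- Both comparisons go through the long word: deletion gives the shorter words in every case,
    -- while insertion uses the hypothesis through `α-forces` and `β-forces`.
    matched-alike⇒∼ α β refl refl (λ π! → γ⇒β ∘ α⇒γ π! , γ⇒α ∘ β⇒γ π!)
  , matched-alike⇒∼ β γ refl refl (λ π! → β⇒γ π! , γ⇒β)
  where
  s   = lookup ν i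
  ν-β = ν [ i ]≔ r
  ν-γ = insertAt ν (inject₁ i) r
  H   = (r , s) ∷ []

  α β γ : ArrowPattern (suc m)
  α = arrowPattern ν H ν! (word-covers ν! r∉ν i)
  β = arrowPattern ν-β H (replace-unique ν! r∉ν i) (replace-covers ν! r∉ν i)
  γ = arrowPattern ν-γ H (insert-unique ν! r∉ν (inject₁ i)) (insert-covers ν! r∉ν i)

  r≢s : r ≢ s
  r≢s r≡s = r∉ν (subst (_∈ ν) (sym r≡s) (∈-lookup i ν))

  ν-β-i : lookup ν-β i ≡ r
  ν-β-i = lookup∘update i ν r

  larger : s < r ⊎ (∃[ j ] j < i × s < lookup ν j)
  larger = Sum.map₂ (¬Lmax⇒larger ν! i) h

  α-forces : ArrowForcesAdjacency ν r s
  α-forces = Sum.map₂ (λ (j , j<i , s<ν[j]) → j , i , j<i , s<ν[j] , inj₂ refl) larger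

  β-forces : ArrowForcesAdjacency ν-β r s
  β-forces = Sum.map₂
    (λ (j , j<i , s<ν[j]) →
      -- The larger entry stands at `j < i`, so the replacement leaves it in place; position `i` now
      -- holds the source `r`.
      j , i , j<i , subst (s <_) (sym (lookup∘update′ (<⇒≢ j<i) ν r)) s<ν[j] , inj₁ ν-β-i) larger

  α⇒γ : ∀ {n} {π : Vec (Fin n) n} → Unique π → Matches π r s ν → Matches π r s ν-γ
  α⇒γ π! = matches-insert-source π! r≢s α-forces r∉ν i refl

  β⇒γ : ∀ {n} {π : Vec (Fin n) n} → Unique π → Matches π r s ν-β → Matches π r s ν-γ
  β⇒γ {π = π} π! = subst (Matches π r s) (insertAt-update ν i r)
    ∘ matches-insert-target π! r≢s β-forces (lookup-∉-update ν! r∉ν i) i ν-β-i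

  γ⇒α : ∀ {n} {π : Vec (Fin n) n} → Matches π r s ν-γ → Matches π r s ν
  γ⇒α {π = π} M = subst (Matches π r s) (removeAt-insertAt ν (inject₁ i) r)
    (matches-removeAt M (inject₁ i))

  γ⇒β : ∀ {n} {π : Vec (Fin n) n} → Matches π r s ν-γ → Matches π r s ν-β
  γ⇒β {π = π} M = subst (Matches π r s) (removeAt-insertAt-suc ν i r) (matches-removeAt M (suc i))
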